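{- Let $G_1=([n],E_1)$ and $G_2=([n],E_2)$ be simple undirected graphs on $n$ vertices each, and let $cp\vartheta$ denote the optimal value of the completely positive program CP-LT associated with $(G_1,G_2)$. Then $cp\vartheta=n$ if and only if $G_1$ and $G_2$ are isomorphic. Moreover, in this case the feasible region of CP-LT (its elements viewed as $n^2\times n^2$ matrices by dropping the row and column indexed by $\omega$) is equal to $\mathcal{P}_{G_1,G_2}$.
   Context: $[n]=\{1,\dots,n\}$. Edges are unordered pairs of distinct vertices; $(i,k)\in E$ means that $\{i,k\}$ is an edge (so $(i,i)\notin E$). $G_1$ and $G_2$ are isomorphic if there is a bijection $\sigma:[n]\to[n]$ with $(\sigma(x),\sigma(y))\in E_2$ if and only if $(x,y)\in E_1$; such a $\sigma$ is called an isomorphism between $G_1$ and $G_2$. A real symmetric $m\times m$ matrix $M$ is completely positive (CP) if $M=QQ^T$ for some real $m\times k$ matrix $Q$ with all entries non-negative. The program CP-LT for $(G_1,G_2)$: the variable is a real symmetric $(n^2+1)\times(n^2+1)$ matrix $Y$ with rows and columns indexed by $\{ij \mid i,j\in[n]\}\cup\{\omega\}$. Maximize $\sum_{i,j\in[n]}Y_{ij,ij}$ subject to: $Y$ is completely positive; $Y_{\omega,\omega}=1$; $Y_{ij,\omega}=Y_{ij,ij}$ for all $i,j\in[n]$; $Y_{ij,ik}=0$ for all $i,j,k\in[n]$ with $j\neq k$; $Y_{ji,ki}=0$ for all $i,j,k\in[n]$ with $j\neq k$; $Y_{ij,kl}=0$ whenever $(i,k)\in E_1$ and $(j,l)\notin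 E_2$; $Y_{ij,kl}=0$ whenever $(i,k)\notin E_1$ and $(j,l)\in E_2$. The feasible region of CP-LT is the set of all matrices satisfying these constraints. Since the $\omega$ row and column of a feasible matrix are determined by its diagonal and $Y_{\omega,\omega}=1$, feasible matrices are identified with the $n^2\times n^2$ matrices obtained by dropping the $\omega$ row and column. For a permutation $\sigma\in S_n$, $P_\sigma$ is its permutation matrix ($[P_\sigma]_{ij}=1$ if $j=\sigma(i)$, and $0$ otherwise), and $P^{[2]}_\sigma$ is the $n^2\times n^2$ matrix with $[P^{[2]}_\sigma]_{ij,kl}=[P_\sigma]_{ij}[P_\sigma]_{kl}$. $\mathcal{P}_{G_1,G_2}$ is the convex hull of $\{P^{[2]}_\sigma \mid \sigma \text{ is an isomorphism between } G_1 \text{ and } G_2\}$.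
   Formalization: In the "moreover" clause the feasible region is restricted to feasible matrices with objective value n (the optimal ones); as printed the clause fails for n ≥ 1, since the zero matrix is always feasible but is not in P_{G1,G2}. -}

module Defs where

open import Algebra.Bundles using (CommutativeRing)
open import Data.Bool.Base using (if_then_else_)
open import Data.Fin.Base using (Fin)
open import Data.Fin.Permutation using (Permutation′; _⟨$⟩ʳ_)
open import Data.Fin.Properties using (_≟_)
open import Data.Maybe.Base using (Maybe; just; nothing)
open import Data.Nat.Base using (ℕ)
open import Data.Product.Base using (Σ-syntax; ∃; ∃-syntax; _×_; _,_)
open import Function.Bundles using (_⇔_)
open import Level using (0ℓ)
open import Relation.Binary.Core using (Rel)
open import Relation.Binary.Definitions using (Decidable; Irreflexive; Symmetric)
open import Relation.Binary.PropositionalEquality.Core using (_≡_; _≢_)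
open import Relation.Binary.Structures using (IsDecTotalOrder)
open import Relation.Nullary.Decidable.Core using (does)
open import Relation.Nullary.Negation.Core using (¬_)

module _ {A : Set} (_≤_ : Rel A 0ℓ) where

  IsUpperBound : (A → Set) → A → Set
  IsUpperBound P u = ∀ x → P x → x ≤ u

  IsSupremum : (A → Set) → A → Set
  IsSupremum P s = IsUpperBound P s × (∀ u → IsUpperBound P u → s ≤ u)

-- The classical axioms of a Dedekind-complete ordered field, which determine
-- ℝ up to isomorphism. Decidability of the order and the existence of
-- arbitrary bounded suprema record that ℝ is the classical field of reals.
record RealNumbers : Set₁ where
  field
    commutativeRing : CommutativeRing 0ℓ 0ℓ

  open CommutativeRing commutativeRing public

  infix 4 _≤_
  field
    _≤_             : Rel Carrier 0ℓ
    isDecTotalOrder : IsDecTotalOrder _≈_ _≤_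
    0≉1             : ¬ (0# ≈ 1#)
    inverse         : ∀ x → ¬ (x ≈ 0#) → ∃[ y ] x * y ≈ 1#
    +-monoˡ-≤       : ∀ x y z → x ≤ y → x + z ≤ y + z
    *-nonNegative   : ∀ x y → 0# ≤ x → 0# ≤ y → 0# ≤ x * y
    supremum        : ∀ (P : Carrier → Set) → ∃ P → ∃ (IsUpperBound _≤_ P) →
                      ∃ (IsSupremum _≤_ P)

record SimpleGraph (n : ℕ) : Set₁ where
  field
    Edge        : Rel (Fin n) 0ℓ
    symmetric   : Symmetric Edge
    irreflexive : Irreflexive _≡_ Edge
    edge?       : Decidable Edge

module _ {n : ℕ} (G₁ G₂ : SimpleGraph n) where
  open SimpleGraph

  IsIsomorphism : Permutation′ n → Set
  IsIsomorphism σ = ∀ x y → Edge G₂ (σ ⟨$⟩ʳ x) (σ ⟨$⟩ʳ y) ⇔ Edge G₁ x y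

  Isomorphic : Set
  Isomorphic = ∃ IsIsomorphism

module Matrices (ℝ : RealNumbers) where
  open RealNumbers ℝ
  open import Algebra.Definitions.RawMonoid +-rawMonoid public
    using (sum) renaming (_×_ to _·_)

  fromℕ : ℕ → Carrier
  fromℕ n = n · 1#

  Matrix : Set → Set
  Matrix I = I → I → Carrier

  infix 4 _≋_
  _≋_ : {I : Set} → Rel (Matrix I) 0ℓ
  A ≋ B = ∀ i j → A i j ≈ B i j

  IsSymmetric : {I : Set} → Matrix I → Set
  IsSymmetric A = ∀ i j → A i j ≈ A j i

  IsCompletelyPositive : {I : Set} → Matrix I → Set
  IsCompletelyPositive {I} M =
    IsSymmetric M ×
    (∃[ k ] Σ[ Q ∈ (I → Fin k → Carrier) ]
      (∀ i t → 0# ≤ Q i t) ×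
      (∀ i j → M i j ≈ sum (λ t → Q i t * Q j t)))

  ConvexHull : {I : Set} → (Matrix I → Set) → Matrix I → Set
  ConvexHull {I} S M =
    ∃[ m ] Σ[ c ∈ (Fin m → Carrier) ] Σ[ A ∈ (Fin m → Matrix I) ]
      (∀ t → 0# ≤ c t) ×
      (sum c ≈ 1#) ×
      (∀ t → S (A t)) ×
      (∀ i j → M i j ≈ sum (λ t → c t * A t i j))

module CP-LT (ℝ : RealNumbers) {n : ℕ} (G₁ G₂ : SimpleGraph n) where
  open RealNumbers ℝ
  open Matrices ℝ public
  open SimpleGraph

  Pair : Set
  Pair = Fin n × Fin n

  Index : Set
  Index = Maybe Pair

  pattern ω       = nothing
  pattern _,,_ i j = just (i , j)

  record IsFeasible (Y : Matrix Index) : Set where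
    field
      completelyPositive : IsCompletelyPositive Y
      corner   : Y ω ω ≈ 1#
      border   : ∀ i j → Y (i ,, j) ω ≈ Y (i ,, j) (i ,, j)
      row      : ∀ i j k → j ≢ k → Y (i ,, j) (i ,, k) ≈ 0#
      column   : ∀ i j k → j ≢ k → Y (j ,, i) (k ,, i) ≈ 0#
      edge₁    : ∀ i j k l → Edge G₁ i k → ¬ Edge G₂ j l →
                 Y (i ,, j) (k ,, l) ≈ 0#
      edge₂    : ∀ i j k l → ¬ Edge G₁ i k → Edge G₂ j l →
                 Y (i ,, j) (k ,, l) ≈ 0#

  drop-ω : Matrix Index → Matrix Pair
  drop-ω Y p q = Y (just p) (just q)

  trace : Matrix Pair → Carrier
  trace M = sum λ i → sum λ j → M (i , j) (i , j)

  FeasibleRegion : Matrix Pair → Set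
  FeasibleRegion M = ∃[ Y ] IsFeasible Y × M ≋ drop-ω Y

  -- Feasible Y has objective value trace (drop-ω Y).
  IsOptimalValue : Carrier → Set
  IsOptimalValue =
    IsSupremum _≤_ (λ v → ∃[ Y ] IsFeasible Y × v ≈ trace (drop-ω Y))

  -- The feasible matrices attaining the value n. Restricting to them is
  -- essential when comparing with 𝒫: the matrix whose only non-zero entry is
  -- a 1 at (ω , ω) is always feasible, so the zero matrix lies in
  -- FeasibleRegion, but for n > 0 it does not lie in 𝒫.
  FeasibleRegionOfValue-n : Matrix Pair → Set
  FeasibleRegionOfValue-n M = FeasibleRegion M × trace M ≈ fromℕ n

  permutationMatrix : Permutation′ n → Matrix (Fin n)
  permutationMatrix σ i j = if does (j ≟ σ ⟨$⟩ʳ i) then 1# else 0#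

  P[2] : Permutation′ n → Matrix Pair
  P[2] σ (i , j) (k , l) = permutationMatrix σ i j * permutationMatrix σ k l

  𝒫 : Matrix Pair → Set
  𝒫 = ConvexHull (λ A → ∃[ σ ] IsIsomorphism G₁ G₂ σ × A ≋ P[2] σ)

{-# OPTIONS --safe #-}

-- Write a feasible Y as Q Qᵀ and let w_t and x_t be the ω-entry and the
-- remaining n × n block of the t-th column of Q. As Q is non-negative, every
-- zero of Y forces zeros in each column: a row or column of x_t has at most one
-- non-zero entry, and the support of x_t is the graph of a partial isomorphism.
-- If r_ti is the sum of row i of x_t, then r_ti² is the sum of the squares of
-- that row, so ∑ w_t² = 1 and the border constraint give
--   n = trace Y + ∑_{t,i} (w_t − r_ti)².
-- Hence trace Y ≤ n. Equality forces r_ti = w_t throughout, that is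
-- x_t = w_t P_σ for an isomorphism σ. If there is no isomorphism, each x_t has
-- a zero row, so that trace Y ≤ n − 1 (a uniform gap, which replaces the
-- attainment of the supremum). Conversely, the columns √c (1 , P_σ) realise a
-- convex combination with coefficients c.
module Submission where

open import Data.Nat.Base using (ℕ; zero; suc)
open import Data.Nat.Properties using (1+n≰n)
open import Data.Fin.Base using (Fin; zero; suc; punchOut)
open import Data.Fin.Permutation using (Permutation′; permutation; _⟨$⟩ʳ_)
open import Data.Fin.Properties as Fin
  using (all?; any?; ¬∀⟶∃¬; injective⇒≤; punchOut-injective; suc-injective)
open import Data.Product.Base using (Σ-syntax; ∃; ∃-syntax; _×_; _,_; proj₁; proj₂; map₂; uncurry)
open import Data.Sum.Base using (_⊎_; inj₁; inj₂; [_,_]′)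
open import Data.Vec.Base using (Vec; []; _∷_; lookup; tabulate)
open import Data.Vec.Properties using (lookup∘tabulate)
open import Function.Base using (_∘_)
open import Function.Bundles using (_⇔_; mk⇔; Equivalence; Injection)
open import Function.Definitions using (Injective)
open import Function.Properties.Inverse using (↔⇒↣)
open import Relation.Binary.Bundles using (Poset)
open import Relation.Binary.PropositionalEquality as ≡ using (_≡_; _≢_)
open import Relation.Binary.Structures using (IsDecTotalOrder)
open import Relation.Nullary.Decidable
  using (Dec; yes; no; map′; _×-dec_; _→-dec_; decidable-stable)
open import Relation.Nullary.Negation using (¬_; contradiction)
open import Relation.Unary using (Decidable)
open import Defs

-- Injective self-maps of finite sets, and exhaustive search.

injective⇒surjective : ∀ {n} {f : Fin n → Fin n} → Injective _≡_ _≡_ f →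
                       ∀ j → ∃[ i ] f i ≡ j
injective⇒surjective {zero}  _ ()
injective⇒surjective {suc n} {f} f-injective j with any? (λ i → f i Fin.≟ j)
... | yes ∃i = ∃i
-- Pigeonhole: if `j` is missed, punching it out of the codomain turns `f` into an injection from
-- `Fin (suc n)` into `Fin n`.
... | no  ∄i = contradiction
  (injective⇒≤ (λ {i} {k} eq → f-injective (punchOut-injective (j≢f i) (j≢f k) eq)))
  1+n≰n
  where
  j≢f : ∀ i → j ≢ f i
  j≢f i eq = ∄i (i , ≡.sym eq)

injective⇒permutation : ∀ {n} {f : Fin n → Fin n} → Injective _≡_ _≡_ f →
                        Σ[ σ ∈ Permutation′ n ] (∀ i → σ ⟨$⟩ʳ i ≡ f i)
injective⇒permutation {f = f} f-injective =
  permutation f f⁻¹ (λ j → proj₂ (f-surjective j))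
    (λ i → f-injective (proj₂ (f-surjective (f i)))) ,
  λ _ → ≡.refl
  where
  f-surjective = injective⇒surjective f-injective
  f⁻¹ = λ j → proj₁ (f-surjective j)

-- Vectors stand in for functions between finite sets, so that the search needs no function
-- extensionality.
anyVec? : ∀ {n} m {P : Vec (Fin n) m → Set} → Decidable P → Dec (∃ P)
anyVec? zero    P? = map′ ([] ,_) (λ { ([] , p) → p }) (P? [])
anyVec? (suc m) P? = map′
  (λ { (x , v , p) → x ∷ v , p })
  (λ { (x ∷ v , p) → x , v , p })
  (any? λ x → anyVec? m λ v → P? (x ∷ v))

-- Deciding graph isomorphism.

module _ {n : ℕ} (G₁ G₂ : SimpleGraph n) where
  open SimpleGraph

  -- Built from explicit quantifiers and implications between decidable propositions, which makes it
  -- decidable by finite checks. Surjectivity comes for free on a finite set.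
  IsEmbedding : (Fin n → Fin n) → Set
  IsEmbedding f =
    (∀ x y → f x ≡ f y → x ≡ y) ×
    (∀ x y → (Edge G₂ (f x) (f y) → Edge G₁ x y) × (Edge G₁ x y → Edge G₂ (f x) (f y)))

  embedding⇒isomorphism : ∀ {f} → IsEmbedding f →
    Σ[ σ ∈ Permutation′ n ] IsIsomorphism G₁ G₂ σ × (∀ i → σ ⟨$⟩ʳ i ≡ f i)
  embedding⇒isomorphism {f} (f-injective , f-edges) =
    σ , (λ x y → mk⇔
      (λ e → proj₁ (f-edges x y) (≡.subst₂ (Edge G₂) (σ≗f x) (σ≗f y) e))
      (λ e → ≡.subst₂ (Edge G₂) (≡.sym (σ≗f x)) (≡.sym (σ≗f y)) (proj₂ (f-edges x y) e))) ,
    σ≗f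
    where
    σ+eq = injective⇒permutation {f = f} (λ {x} {y} → f-injective x y)
    σ = proj₁ σ+eq
    σ≗f = proj₂ σ+eq

  -- This decision is what allows `optimal⇒isomorphic` to argue by contradiction.
  isomorphic? : Dec (Isomorphic G₁ G₂)
  isomorphic? = map′ to from (anyVec? n λ v → embedding? (lookup v))
    where
    embedding? : ∀ f → Dec (IsEmbedding f)
    embedding? f =
      (all? λ x → all? λ y → (f x Fin.≟ f y) →-dec (x Fin.≟ y)) ×-dec
      (all? λ x → all? λ y →
        (edge? G₂ (f x) (f y) →-dec edge? G₁ x y) ×-dec
        (edge? G₁ x y →-dec edge? G₂ (f x) (f y)))

    to : ∃ (IsEmbedding ∘ lookup) → Isomorphic G₁ G₂
    to (v , emb) with embedding⇒isomorphism emb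
    ... | σ , iso , _ = σ , iso

    from : Isomorphic G₁ G₂ → ∃ (IsEmbedding ∘ lookup)
    from (σ , iso) = v ,
      (λ x y eq → Injection.injective (↔⇒↣ σ) (≡.trans (≡.sym (v≗σ x)) (≡.trans eq (v≗σ y)))) ,
      (λ x y →
        (λ e → Equivalence.to (iso x y) (≡.subst₂ (Edge G₂) (v≗σ x) (v≗σ y) e)) ,
        (λ e → ≡.subst₂ (Edge G₂) (≡.sym (v≗σ x)) (≡.sym (v≗σ y)) (Equivalence.from (iso x y) e)))
      where
      v = tabulate (σ ⟨$⟩ʳ_)
      v≗σ : ∀ x → lookup v x ≡ σ ⟨$⟩ʳ x
      v≗σ = lookup∘tabulate (σ ⟨$⟩ʳ_)

-- Ordered-field arithmetic and square roots.

module RealProperties (ℝ : RealNumbers) where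
  open RealNumbers ℝ hiding (zero)
  open IsDecTotalOrder isDecTotalOrder public
    using (_≟_; antisym; total)
    renaming (reflexive to ≤-reflexive; trans to ≤-trans; refl to ≤-refl)
  open Matrices ℝ using (sum; fromℕ)
  open import Algebra.Properties.Semiring.Sum semiring public
    using (sum-cong-≋; sum-replicate; sum-replicate-zero; ∑-distrib-+; ∑-comm;
           *-distribˡ-sum; *-distribʳ-sum)
  open import Algebra.Properties.Ring ring using (-‿distribˡ-*; -‿distribʳ-*; -‿involutive)
  open import Algebra.Solver.Ring.NaturalCoefficients.Default commutativeSemiring
    using (solve; _:=_; _:+_; _:*_; con)

  poset : Poset _ _ _
  poset = record { isPartialOrder = IsDecTotalOrder.isPartialOrder isDecTotalOrder }

  open import Relation.Binary.Reasoning.PartialOrder poset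

  +-monoʳ-≤ : ∀ x {y z} → y ≤ z → x + y ≤ x + z
  +-monoʳ-≤ x {y} {z} y≤z = begin
    x + y ≈⟨ +-comm x y ⟩
    y + x ≤⟨ +-monoˡ-≤ y z x y≤z ⟩
    z + x ≈⟨ +-comm z x ⟩
    x + z ∎

  +-mono-≤ : ∀ {x y u v} → x ≤ y → u ≤ v → x + u ≤ y + v
  +-mono-≤ x≤y u≤v = ≤-trans (+-monoˡ-≤ _ _ _ x≤y) (+-monoʳ-≤ _ u≤v)

  +-cancelʳ-≤ : ∀ {x y} z → x + z ≤ y + z → x ≤ y
  +-cancelʳ-≤ {x} {y} z x+z≤y+z = begin
    x               ≈⟨ undo x ⟨
    (x + z) + (- z) ≤⟨ +-monoˡ-≤ _ _ _ x+z≤y+z ⟩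
    (y + z) + (- z) ≈⟨ undo y ⟩
    y               ∎
    where
    undo : ∀ u → (u + z) + (- z) ≈ u
    undo u = trans (+-assoc u z (- z)) (trans (+-congˡ (-‿inverseʳ z)) (+-identityʳ u))

  x≤x+y : ∀ x {y} → 0# ≤ y → x ≤ x + y
  x≤x+y x 0≤y = ≤-trans (≤-reflexive (sym (+-identityʳ x))) (+-monoʳ-≤ x 0≤y)

  +-nonNegative : ∀ {x y} → 0# ≤ x → 0# ≤ y → 0# ≤ x + y
  +-nonNegative 0≤x 0≤y = ≤-trans 0≤x (x≤x+y _ 0≤y)

  x+[y-x]≈y : ∀ x y → x + (y - x) ≈ y
  x+[y-x]≈y x y = begin-equality
    x + (y - x)   ≈⟨ +-congˡ (+-comm y (- x)) ⟩
    x + (- x + y) ≈⟨ +-assoc x (- x) y ⟨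
    (x - x) + y   ≈⟨ +-congʳ (-‿inverseʳ x) ⟩
    0# + y        ≈⟨ +-identityˡ y ⟩
    y             ∎

  x≤y⇒0≤y-x : ∀ {x y} → x ≤ y → 0# ≤ y - x
  x≤y⇒0≤y-x {x} {y} x≤y = begin
    0#    ≈⟨ -‿inverseʳ x ⟨
    x - x ≤⟨ +-monoˡ-≤ x y (- x) x≤y ⟩
    y - x ∎

  *-monoʳ-≤ : ∀ {x y z} → 0# ≤ x → y ≤ z → x * y ≤ x * z
  *-monoʳ-≤ {x} {y} {z} 0≤x y≤z = begin
    x * y               ≤⟨ x≤x+y _ (*-nonNegative _ _ 0≤x (x≤y⇒0≤y-x y≤z)) ⟩
    x * y + x * (z - y) ≈⟨ distribˡ x y (z - y) ⟨
    x * (y + (z - y))   ≈⟨ *-congˡ (x+[y-x]≈y y z) ⟩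
    x * z               ∎

  x²-nonNegative : ∀ x → 0# ≤ x * x
  x²-nonNegative x with total 0# x
  ... | inj₁ 0≤x = *-nonNegative x x 0≤x 0≤x
  ... | inj₂ x≤0 = begin
    0#                    ≤⟨ *-nonNegative _ _ 0≤-x 0≤-x ⟩
    (0# - x) * (0# - x)   ≈⟨ *-cong (+-identityˡ _) (+-identityˡ _) ⟩
    (- x) * (- x)         ≈⟨ -‿distribˡ-* x (- x) ⟨
    - (x * (- x))         ≈⟨ -‿cong (-‿distribʳ-* x x) ⟨
    - - (x * x)           ≈⟨ -‿involutive (x * x) ⟩
    x * x                 ∎
    where 0≤-x = x≤y⇒0≤y-x x≤0

  0≤1 : 0# ≤ 1#
  0≤1 = ≤-trans (x²-nonNegative 1#) (≤-reflexive (*-identityˡ 1#))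

  xy≈0⇒x≈0∨y≈0 : ∀ {x y} → x * y ≈ 0# → x ≈ 0# ⊎ y ≈ 0#
  xy≈0⇒x≈0∨y≈0 {x} {y} xy≈0 with x ≟ 0#
  ... | yes x≈0 = inj₁ x≈0
  ... | no  x≉0 with inverse x x≉0
  ...   | x⁻¹ , xx⁻¹≈1 = inj₂ (begin-equality
    y             ≈⟨ *-identityˡ y ⟨
    1# * y        ≈⟨ *-congʳ xx⁻¹≈1 ⟨
    x * x⁻¹ * y   ≈⟨ solve 3 (λ x i y → x :* i :* y := i :* (x :* y)) refl x x⁻¹ y ⟩
    x⁻¹ * (x * y) ≈⟨ *-congˡ xy≈0 ⟩
    x⁻¹ * 0#      ≈⟨ zeroʳ x⁻¹ ⟩
    0#            ∎)

  x²≈0⇒x≈0 : ∀ {x} → x * x ≈ 0# → x ≈ 0#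
  x²≈0⇒x≈0 x²≈0 with xy≈0⇒x≈0∨y≈0 x²≈0
  ... | inj₁ x≈0 = x≈0
  ... | inj₂ x≈0 = x≈0

  x+y≈0⇒x≈0 : ∀ {x y} → 0# ≤ x → 0# ≤ y → x + y ≈ 0# → x ≈ 0#
  x+y≈0⇒x≈0 0≤x 0≤y x+y≈0 = antisym (≤-trans (x≤x+y _ 0≤y) (≤-reflexive x+y≈0)) 0≤x

  -- Substituting `y + d` for `x` leaves an identity without subtraction, which the semiring solver
  -- can prove. Summed over all columns and rows, with `w` for `x` and `r` for `y`, it yields
  -- `T+defect≈n`.
  x²+y²≈2xy+[x-y]² : ∀ x y → x * x + y * y ≈ (y * x + y * x) + (x - y) * (x - y)
  x²+y²≈2xy+[x-y]² x y = begin-equality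
    x * x + y * y                        ≈⟨ +-congʳ (*-cong x≈y+d x≈y+d) ⟩
    (y + d) * (y + d) + y * y            ≈⟨ solve 2 (λ y d →
      (y :+ d) :* (y :+ d) :+ y :* y := (y :* (y :+ d) :+ y :* (y :+ d)) :+ d :* d) refl y d ⟩
    (y * (y + d) + y * (y + d)) + d * d  ≈⟨ +-congʳ (+-cong (*-congˡ x≈y+d) (*-congˡ x≈y+d)) ⟨
    (y * x + y * x) + d * d              ∎
    where
    d = x - y
    x≈y+d = sym (x+[y-x]≈y y x)

  -- If `y ≤ x`, write `x = y + d` with `d` non-negative. The hypothesis then bounds `d² + 2yd` by
  -- zero, so `d` vanishes.
  x²≤y²⇒x≤y : ∀ {x y} → 0# ≤ y → x * x ≤ y * y → x ≤ y
  x²≤y²⇒x≤y {x} {y} 0≤y x²≤y² with total x y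
  ... | inj₁ x≤y = x≤y
  ... | inj₂ y≤x = ≤-reflexive (begin-equality
    x           ≈⟨ x+[y-x]≈y y x ⟨
    y + d       ≈⟨ +-congˡ d≈0 ⟩
    y + 0#      ≈⟨ +-identityʳ y ⟩
    y           ∎)
    where
    d = x - y
    0≤d = x≤y⇒0≤y-x y≤x

    excess : d * d + (y * d + y * d) ≤ 0#
    excess = +-cancelʳ-≤ (y * y) (begin
      (d * d + (y * d + y * d)) + y * y ≈⟨ solve 2 (λ y d →
        (d :* d :+ (y :* d :+ y :* d)) :+ y :* y := (y :+ d) :* (y :+ d)) refl y d ⟩
      (y + d) * (y + d)                 ≈⟨ *-cong (x+[y-x]≈y y x) (x+[y-x]≈y y x) ⟩
      x * x                             ≤⟨ x²≤y² ⟩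
      y * y                             ≈⟨ +-identityˡ (y * y) ⟨
      0# + y * y                        ∎)

    0≤2yd = +-nonNegative (*-nonNegative y d 0≤y 0≤d) (*-nonNegative y d 0≤y 0≤d)

    d≈0 : d ≈ 0#
    d≈0 = x²≈0⇒x≈0 (antisym (≤-trans (x≤x+y _ 0≤2yd) excess) (x²-nonNegative d))

  x+x≤y+y⇒x≤y : ∀ {x y} → x + x ≤ y + y → x ≤ y
  x+x≤y+y⇒x≤y {x} {y} 2x≤2y with total x y
  ... | inj₁ x≤y = x≤y
  ... | inj₂ y≤x = +-cancelʳ-≤ x (≤-trans 2x≤2y (+-monoʳ-≤ y y≤x))

  -- The inverse satisfies `y = x y²`, a product of non-negative factors.
  inverse-nonNegative : ∀ {x y} → 0# ≤ x → x * y ≈ 1# → 0# ≤ y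
  inverse-nonNegative {x} {y} 0≤x xy≈1 = begin
    0#          ≤⟨ *-nonNegative _ _ 0≤x (x²-nonNegative y) ⟩
    x * (y * y) ≈⟨ *-assoc x y y ⟨
    x * y * y   ≈⟨ *-congʳ xy≈1 ⟩
    1# * y      ≈⟨ *-identityˡ y ⟩
    y           ∎

  2≉0 : ¬ (1# + 1# ≈ 0#)
  2≉0 2≈0 = 0≉1 (sym (x+y≈0⇒x≈0 0≤1 0≤1 2≈0))

  half : ∀ x → ∃[ y ] y + y ≈ x
  half x with inverse (1# + 1#) 2≉0
  ... | h , 2h≈1 = h * x , (begin-equality
    h * x + h * x        ≈⟨ solve 2 (λ h x → h :* x :+ h :* x := (con 1 :+ con 1) :* h :* x) refl h x ⟩
    (1# + 1#) * h * x    ≈⟨ *-congʳ 2h≈1 ⟩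
    1# * x               ≈⟨ *-identityˡ x ⟩
    x                    ∎)

  -- AM-GM without division: the two sides differ by `(x - y)²`.
  4xy≤[x+y]² : ∀ x y → (x * y + x * y) + (x * y + x * y) ≤ (x + y) * (x + y)
  4xy≤[x+y]² x y = begin
    (x * y + x * y) + (x * y + x * y)
      ≤⟨ x≤x+y _ (x²-nonNegative (x - y)) ⟩
    (x * y + x * y) + (x * y + x * y) + (x - y) * (x - y)
      ≈⟨ solve 3 (λ x y e → (x :* y :+ x :* y) :+ (x :* y :+ x :* y) :+ e :=
           ((y :* x :+ y :* x) :+ e) :+ (x :* y :+ x :* y)) refl x y ((x - y) * (x - y)) ⟩
    ((y * x + y * x) + (x - y) * (x - y)) + (x * y + x * y)
      ≈⟨ +-congʳ (x²+y²≈2xy+[x-y]² x y) ⟨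
    (x * x + y * y) + (x * y + x * y)
      ≈⟨ solve 2 (λ x y → (x :* x :+ y :* y) :+ (x :* y :+ x :* y) := (x :+ y) :* (x :+ y)) refl x y ⟩
    (x + y) * (x + y) ∎

  -- For c > 0 let s be the supremum of {y ≥ 0 ∣ y² ≤ c} and u = (s + c/s)/2.
  -- By AM-GM c ≤ u², so u is an upper bound of that set and c/u belongs to it:
  -- s ≤ u gives s² ≤ c, and c/u ≤ s gives c ≤ s².
  sqrt : ∀ {c} → 0# ≤ c → ∃[ s ] 0# ≤ s × s * s ≈ c
  sqrt {c} 0≤c with c ≟ 0#
  ... | yes c≈0 = 0# , ≤-refl , trans (zeroˡ 0#) (sym c≈0)
  ... | no  c≉0 = s , 0≤s , antisym s²≤c c≤s²
    where
    P : Carrier → Set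
    P y = 0# ≤ y × y * y ≤ c

    P-0 : P 0#
    P-0 = ≤-refl , ≤-trans (≤-reflexive (zeroˡ 0#)) 0≤c

    0≤1+c = +-nonNegative 0≤1 0≤c

    -- The bound works for small and large `c` alike, since `(1 + c)² = c + (1 + c + c²)`.
    P-bounded : IsUpperBound _≤_ P (1# + c)
    P-bounded y (_ , y²≤c) = x²≤y²⇒x≤y 0≤1+c (begin
      y * y                          ≤⟨ y²≤c ⟩
      c                              ≤⟨ x≤x+y c (+-nonNegative 0≤1+c (x²-nonNegative c)) ⟩
      c + ((1# + c) + c * c)         ≈⟨ solve 1 (λ c →
        c :+ ((con 1 :+ c) :+ c :* c) := (con 1 :+ c) :* (con 1 :+ c)) refl c ⟩
      (1# + c) * (1# + c)            ∎)

    s+sup = supremum P (0# , P-0) (1# + c , P-bounded)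
    s = proj₁ s+sup
    s-upper = proj₁ (proj₂ s+sup)
    s-least = proj₂ (proj₂ s+sup)

    0≤s : 0# ≤ s
    0≤s = s-upper 0# P-0

    1+c≉0 : ¬ (1# + c ≈ 0#)
    1+c≉0 1+c≈0 = 0≉1 (sym (x+y≈0⇒x≈0 0≤1 0≤c 1+c≈0))

    e+inv = inverse (1# + c) 1+c≉0
    e = proj₁ e+inv
    [1+c]e≈1 = proj₂ e+inv
    0≤e = inverse-nonNegative 0≤1+c [1+c]e≈1
    0≤ce = *-nonNegative c e 0≤c 0≤e

    -- The witness `c / (1 + c)` is a non-zero member of the set, so `s` is non-zero and may be
    -- divided by. Its square is at most `c` because `c (1 + c)²` exceeds `c²` by `c (1 + c + c²)`.
    P-ce : P (c * e)
    P-ce = 0≤ce , (begin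
      c * e * (c * e)
        ≤⟨ x≤x+y _ (*-nonNegative _ _ 0≤c
             (*-nonNegative _ _ (+-nonNegative 0≤1+c (x²-nonNegative c)) (x²-nonNegative e))) ⟩
      c * e * (c * e) + c * (((1# + c) + c * c) * (e * e))
        ≈⟨ solve 2 (λ c e →
             c :* e :* (c :* e) :+ c :* (((con 1 :+ c) :+ c :* c) :* (e :* e)) :=
             c :* (((con 1 :+ c) :* e) :* ((con 1 :+ c) :* e))) refl c e ⟩
      c * (((1# + c) * e) * ((1# + c) * e)) ≈⟨ *-congˡ (*-cong [1+c]e≈1 [1+c]e≈1) ⟩
      c * (1# * 1#)                         ≈⟨ *-congˡ (*-identityˡ 1#) ⟩
      c * 1#                                ≈⟨ *-identityʳ c ⟩
      c                                     ∎)

    s≉0 : ¬ (s ≈ 0#)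
    s≉0 s≈0 = [ c≉0 , e≉0 ]′ (xy≈0⇒x≈0∨y≈0
      (antisym (≤-trans (s-upper (c * e) P-ce) (≤-reflexive s≈0)) 0≤ce))
      where
      e≉0 : ¬ (e ≈ 0#)
      e≉0 e≈0 = 0≉1 (trans (sym (zeroʳ (1# + c))) (trans (*-congˡ (sym e≈0)) [1+c]e≈1))

    s⁻¹+inv = inverse s s≉0
    s⁻¹ = proj₁ s⁻¹+inv
    a = c * s⁻¹

    0≤a : 0# ≤ a
    0≤a = *-nonNegative _ _ 0≤c (inverse-nonNegative 0≤s (proj₂ s⁻¹+inv))

    sa≈c : s * a ≈ c
    sa≈c = begin-equality
      s * (c * s⁻¹) ≈⟨ solve 3 (λ s c i → s :* (c :* i) := c :* (s :* i)) refl s c s⁻¹ ⟩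
      c * (s * s⁻¹) ≈⟨ *-congˡ (proj₂ s⁻¹+inv) ⟩
      c * 1#        ≈⟨ *-identityʳ c ⟩
      c             ∎

    u+half = half (s + a)
    u = proj₁ u+half
    2u≈s+a = proj₂ u+half

    0≤u : 0# ≤ u
    0≤u = x+x≤y+y⇒x≤y (begin
      0# + 0# ≈⟨ +-identityˡ 0# ⟩
      0#      ≤⟨ +-nonNegative 0≤s 0≤a ⟩
      s + a   ≈⟨ 2u≈s+a ⟨
      u + u   ∎)

    c≤u² : c ≤ u * u
    c≤u² = x+x≤y+y⇒x≤y (x+x≤y+y⇒x≤y (begin
      (c + c) + (c + c)                         ≈⟨ +-cong (+-cong sa≈c sa≈c) (+-cong sa≈c sa≈c) ⟨
      (s * a + s * a) + (s * a + s * a)         ≤⟨ 4xy≤[x+y]² s a ⟩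
      (s + a) * (s + a)                         ≈⟨ *-cong 2u≈s+a 2u≈s+a ⟨
      (u + u) * (u + u)                         ≈⟨ solve 1 (λ u →
        (u :+ u) :* (u :+ u) := (u :* u :+ u :* u) :+ (u :* u :+ u :* u)) refl u ⟩
      (u * u + u * u) + (u * u + u * u)         ∎))

    s≤u : s ≤ u
    s≤u = s-least u λ y (_ , y²≤c) → x²≤y²⇒x≤y 0≤u (≤-trans y²≤c c≤u²)

    s²≤c : s * s ≤ c
    s²≤c = begin
      -- As `2u = s + a`, the inequality `s ≤ u` amounts to `s ≤ a`.
      s * s ≤⟨ *-monoʳ-≤ 0≤s (+-cancelʳ-≤ s (begin
        s + s ≤⟨ +-mono-≤ s≤u s≤u ⟩
        u + u ≈⟨ 2u≈s+a ⟩
        s + a ≈⟨ +-comm s a ⟩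
        a + s ∎)) ⟩
      s * a ≈⟨ sa≈c ⟩
      c     ∎

    u≉0 : ¬ (u ≈ 0#)
    u≉0 u≈0 = c≉0 (antisym (≤-trans c≤u² (≤-reflexive (trans (*-congʳ u≈0) (zeroˡ u)))) 0≤c)

    v+inv = inverse u u≉0
    v = proj₁ v+inv
    uv≈1 = proj₂ v+inv

    P-cv : P (c * v)
    P-cv = *-nonNegative _ _ 0≤c (inverse-nonNegative 0≤u uv≈1) , (begin
      c * v * (c * v)         ≈⟨ solve 2 (λ c v → c :* v :* (c :* v) := c :* v :* v :* c) refl c v ⟩
      -- With `v = 1/u`, one factor `c` of `(c/u)²` is enlarged to `u²`, which cancels both
      -- inverses.
      c * v * v * c           ≤⟨ *-monoʳ-≤ (≤-trans (*-nonNegative _ _ 0≤c (x²-nonNegative v))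
                                   (≤-reflexive (sym (*-assoc c v v)))) c≤u² ⟩
      c * v * v * (u * u)     ≈⟨ solve 3 (λ c v u →
        c :* v :* v :* (u :* u) := c :* ((u :* v) :* (u :* v))) refl c v u ⟩
      c * ((u * v) * (u * v)) ≈⟨ *-congˡ (*-cong uv≈1 uv≈1) ⟩
      c * (1# * 1#)           ≈⟨ *-congˡ (*-identityˡ 1#) ⟩
      c * 1#                  ≈⟨ *-identityʳ c ⟩
      c                       ∎)

    c≤us : c ≤ u * s
    c≤us = begin
      c           ≈⟨ *-identityʳ c ⟨
      c * 1#      ≈⟨ *-congˡ uv≈1 ⟨
      c * (u * v) ≈⟨ solve 3 (λ c u v → c :* (u :* v) := u :* (c :* v)) refl c u v ⟩
      u * (c * v) ≤⟨ *-monoʳ-≤ 0≤u (s-upper (c * v) P-cv) ⟩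
      u * s       ∎

    c≤s² : c ≤ s * s
    -- Doubling `c ≤ u s` gives `2c ≤ (s + a) s = s² + c`.
    c≤s² = +-cancelʳ-≤ c (begin
      c + c         ≤⟨ +-mono-≤ c≤us c≤us ⟩
      u * s + u * s ≈⟨ distribʳ s u u ⟨
      (u + u) * s   ≈⟨ *-congʳ 2u≈s+a ⟩
      (s + a) * s   ≈⟨ solve 2 (λ s a → (s :+ a) :* s := s :* s :+ s :* a) refl s a ⟩
      s * s + s * a ≈⟨ +-congˡ sa≈c ⟩
      s * s + c     ∎)

  -- Finite sums.

  sum-≈0 : ∀ {n} {f : Fin n → Carrier} → (∀ i → f i ≈ 0#) → sum f ≈ 0#
  sum-≈0 {n} f≈0 = trans (sum-cong-≋ f≈0) (sum-replicate-zero n)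

  sum-nonNegative : ∀ {n} {f : Fin n → Carrier} → (∀ i → 0# ≤ f i) → 0# ≤ sum f
  sum-nonNegative {zero}  0≤f = ≤-refl
  sum-nonNegative {suc n} 0≤f = +-nonNegative (0≤f zero) (sum-nonNegative (0≤f ∘ suc))

  sum-mono-≤ : ∀ {n} {f g : Fin n → Carrier} → (∀ i → f i ≤ g i) → sum f ≤ sum g
  sum-mono-≤ {zero}  f≤g = ≤-refl
  sum-mono-≤ {suc n} f≤g = +-mono-≤ (f≤g zero) (sum-mono-≤ (f≤g ∘ suc))

  f[i]≤sum : ∀ {n} {f : Fin n → Carrier} → (∀ i → 0# ≤ f i) → ∀ i → f i ≤ sum f
  f[i]≤sum 0≤f zero    = x≤x+y _ (sum-nonNegative (0≤f ∘ suc))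
  f[i]≤sum {f = f} 0≤f (suc i) = begin
    f (suc i)                ≤⟨ f[i]≤sum (0≤f ∘ suc) i ⟩
    sum (f ∘ suc)            ≤⟨ x≤x+y _ (0≤f zero) ⟩
    sum (f ∘ suc) + f zero   ≈⟨ +-comm _ _ ⟩
    f zero + sum (f ∘ suc)   ∎

  sum≈0⇒f[i]≈0 : ∀ {n} {f : Fin n → Carrier} → (∀ i → 0# ≤ f i) → sum f ≈ 0# → ∀ i → f i ≈ 0#
  sum≈0⇒f[i]≈0 0≤f sum≈0 i = antisym (≤-trans (f[i]≤sum 0≤f i) (≤-reflexive sum≈0)) (0≤f i)

  sum-single : ∀ {n} (f : Fin n → Carrier) i → (∀ j → j ≢ i → f j ≈ 0#) → sum f ≈ f i
  sum-single f zero f≈0 =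
    trans (+-congˡ (sum-≈0 λ j → f≈0 (suc j) λ ())) (+-identityʳ (f zero))
  sum-single f (suc i) f≈0 =
    trans (+-cong (f≈0 zero λ ()) (sum-single (f ∘ suc) i λ j j≢i → f≈0 (suc j) (j≢i ∘ suc-injective)))
          (+-identityˡ (f (suc i)))

  -- All cross terms of the expanded square vanish. It is applied to a row of a block, where the row
  -- constraint kills the products of distinct entries.
  sum-sq : ∀ {n} (f : Fin n → Carrier) → (∀ i j → i ≢ j → f i * f j ≈ 0#) →
           sum f * sum f ≈ sum (λ i → f i * f i)
  sum-sq {zero}  f orth = zeroˡ 0#
  sum-sq {suc n} f orth = begin-equality
    (h + S) * (h + S)             ≈⟨ solve 2 (λ h S →
      (h :+ S) :* (h :+ S) := h :* h :+ (h :* S :+ h :* S) :+ S :* S) refl h S ⟩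
    h * h + (h * S + h * S) + S * S ≈⟨ +-congʳ (+-congˡ (trans (+-cong hS≈0 hS≈0) (+-identityˡ 0#))) ⟩
    h * h + 0# + S * S            ≈⟨ +-cong (+-identityʳ _)
      (sum-sq (f ∘ suc) λ i j i≢j → orth (suc i) (suc j) (i≢j ∘ suc-injective)) ⟩
    h * h + sum (λ i → f (suc i) * f (suc i)) ∎
    where
    h = f zero
    S = sum (f ∘ suc)
    hS≈0 : h * S ≈ 0#
    hS≈0 = trans (*-distribˡ-sum h (f ∘ suc)) (sum-≈0 λ i → orth zero (suc i) λ ())

  ∑∑-cong : ∀ {m n} {f g : Fin m → Fin n → Carrier} → (∀ i j → f i j ≈ g i j) →
            sum (λ i → sum (f i)) ≈ sum (λ i → sum (g i))
  ∑∑-cong f≈g = sum-cong-≋ λ i → sum-cong-≋ (f≈g i)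

  ∑∑-distrib-+ : ∀ {m n} (f g : Fin m → Fin n → Carrier) →
    sum (λ i → sum λ j → f i j + g i j) ≈ sum (λ i → sum (f i)) + sum (λ i → sum (g i))
  ∑∑-distrib-+ f g = trans (sum-cong-≋ λ i → ∑-distrib-+ (f i) (g i))
                           (∑-distrib-+ (λ i → sum (f i)) (λ i → sum (g i)))

  ∑∑∑-rotate : ∀ {l m n} (f : Fin l → Fin m → Fin n → Carrier) →
    sum (λ t → sum λ i → sum λ j → f t i j) ≈ sum (λ i → sum λ j → sum λ t → f t i j)
  ∑∑∑-rotate f = trans (∑-comm λ t i → sum (f t i))
                       (sum-cong-≋ λ i → ∑-comm λ t j → f t i j)

  -- Serves twice: for the weights `w t * w t` of a factorisation and for the coefficients of a
  -- convex combination.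
  ∑c≈1⇒∑∑c≈n : ∀ {m} n (c : Fin m → Carrier) → sum c ≈ 1# →
                sum (λ t → sum {n} λ _ → c t) ≈ fromℕ n
  ∑c≈1⇒∑∑c≈n {m} n c ∑c≈1 = begin-equality
    (sum λ t → sum {n} λ _ → c t) ≈⟨ ∑-comm {m} {n} (λ t _ → c t) ⟩
    (sum {n} λ _ → sum c)         ≈⟨ sum-cong-≋ {n} (λ _ → ∑c≈1) ⟩
    (sum {n} λ _ → 1#)            ≈⟨ sum-replicate n ⟩
    fromℕ n                       ∎

module CP-LTProperties (ℝ : RealNumbers) {n : ℕ} (G₁ G₂ : SimpleGraph n) where
  open RealNumbers ℝ hiding (zero)
  open RealProperties ℝ
  open CP-LT ℝ G₁ G₂
  open SimpleGraph
  open import Algebra.Properties.Group +-group using (∙-cancelˡ; ε⁻¹≈ε; x∙y⁻¹≈ε⇒x≈y)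
  open import Algebra.Solver.Ring.NaturalCoefficients.Default commutativeSemiring
    using (solve; _:=_; _:*_)
  open import Relation.Binary.Reasoning.PartialOrder poset

  -- Permutation matrices.

  permutationMatrix-cases : ∀ σ i j →
    (j ≡ σ ⟨$⟩ʳ i × permutationMatrix σ i j ≈ 1#) ⊎
    (j ≢ σ ⟨$⟩ʳ i × permutationMatrix σ i j ≈ 0#)
  permutationMatrix-cases σ i j with j Fin.≟ (σ ⟨$⟩ʳ i)
  ... | yes j≡σi = inj₁ (j≡σi , refl)
  ... | no  j≢σi = inj₂ (j≢σi , refl)

  permutationMatrix-idem : ∀ σ i j →
    permutationMatrix σ i j * permutationMatrix σ i j ≈ permutationMatrix σ i j
  permutationMatrix-idem σ i j with permutationMatrix-cases σ i j
  ... | inj₁ (_ , p≈1) = trans (*-congʳ p≈1) (*-identityˡ _)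
  ... | inj₂ (_ , p≈0) = trans (*-congʳ p≈0) (trans (zeroˡ _) (sym p≈0))

  -- Each entry equals its own square.
  permutationMatrix-nonNegative : ∀ σ i j → 0# ≤ permutationMatrix σ i j
  permutationMatrix-nonNegative σ i j =
    ≤-trans (x²-nonNegative _) (≤-reflexive (permutationMatrix-idem σ i j))

  permutationMatrix-rowSum : ∀ σ i → sum (permutationMatrix σ i) ≈ 1#
  permutationMatrix-rowSum σ i = trans (sum-single _ (σ ⟨$⟩ʳ i) off) on
    where
    off : ∀ j → j ≢ σ ⟨$⟩ʳ i → permutationMatrix σ i j ≈ 0#
    off j j≢σi with permutationMatrix-cases σ i j
    ... | inj₁ (j≡σi , _) = contradiction j≡σi j≢σi
    ... | inj₂ (_ , p≈0)  = p≈0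

    on : permutationMatrix σ i (σ ⟨$⟩ʳ i) ≈ 1#
    on with permutationMatrix-cases σ i (σ ⟨$⟩ʳ i)
    ... | inj₁ (_ , p≈1)   = p≈1
    ... | inj₂ (σi≢σi , _) = contradiction ≡.refl σi≢σi

  P[2]≈0 : ∀ σ i j k l → ¬ (j ≡ σ ⟨$⟩ʳ i × l ≡ σ ⟨$⟩ʳ k) → P[2] σ (i , j) (k , l) ≈ 0#
  P[2]≈0 σ i j k l ≢ with permutationMatrix-cases σ i j | permutationMatrix-cases σ k l
  ... | inj₂ (_ , p≈0) | _                = trans (*-congʳ p≈0) (zeroˡ _)
  ... | inj₁ _         | inj₂ (_ , q≈0)   = trans (*-congˡ q≈0) (zeroʳ _)
  ... | inj₁ (j≡ , _)  | inj₁ (l≡ , _)    = contradiction (j≡ , l≡) ≢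

  -- The zero constraints of CP-LT, as inherited by each block x_t.
  record IsPartialIsomorphism (x : Matrix (Fin n)) : Set where
    field
      nonNegative : ∀ i j → 0# ≤ x i j
      row         : ∀ i j k → j ≢ k → x i j * x i k ≈ 0#
      column      : ∀ i j k → j ≢ k → x j i * x k i ≈ 0#
      edge₁       : ∀ i j k l → Edge G₁ i k → ¬ Edge G₂ j l → x i j * x k l ≈ 0#
      edge₂       : ∀ i j k l → ¬ Edge G₁ i k → Edge G₂ j l → x i j * x k l ≈ 0#

  -- Blocks without zero rows and blocks with constant row sums.

  module _ {x : Matrix (Fin n)} (x-partial : IsPartialIsomorphism x) where
    open IsPartialIsomorphism x-partial

    module _ (rowSum≉0 : ∀ i → ¬ (sum (x i) ≈ 0#)) where
      support : ∀ i → ∃[ j ] ¬ (x i j ≈ 0#)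
      support i = ¬∀⟶∃¬ n _ (λ j → x i j ≟ 0#) (rowSum≉0 i ∘ sum-≈0)

      -- Products of the chosen entries are non-zero, as a field has no zero divisors. A failure of
      -- injectivity or of edge preservation in either direction would place such a product under
      -- one of the zero constraints.
      total⇒embedding : IsEmbedding G₁ G₂ (proj₁ ∘ support)
      total⇒embedding = f-injective , f-edges
        where
        f : Fin n → Fin n
        f i = proj₁ (support i)

        product≉0 : ∀ i k → ¬ (x i (f i) * x k (f k) ≈ 0#)
        product≉0 i k xx≈0 with xy≈0⇒x≈0∨y≈0 xx≈0
        ... | inj₁ ≈0 = proj₂ (support i) ≈0
        ... | inj₂ ≈0 = proj₂ (support k) ≈0

        f-injective : ∀ i k → f i ≡ f k → i ≡ k
        f-injective i k fi≡fk = decidable-stable (i Fin.≟ k) λ i≢k → product≉0 i k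
          (≡.subst (λ j → x i (f i) * x k j ≈ 0#) fi≡fk (column (f i) i k i≢k))

        f-edges : ∀ i k → (Edge G₂ (f i) (f k) → Edge G₁ i k) × (Edge G₁ i k → Edge G₂ (f i) (f k))
        f-edges i k =
          (λ e₂ → decidable-stable (edge? G₁ i k) λ ¬e₁ → product≉0 i k (edge₂ _ _ _ _ ¬e₁ e₂)) ,
          (λ e₁ → decidable-stable (edge? G₂ (f i) (f k)) λ ¬e₂ →
            product≉0 i k (edge₁ _ _ _ _ e₁ ¬e₂))

      total⇒isomorphism :
        Σ[ σ ∈ Permutation′ n ] IsIsomorphism G₁ G₂ σ × (∀ i → ¬ (x i (σ ⟨$⟩ʳ i) ≈ 0#))
      total⇒isomorphism with embedding⇒isomorphism G₁ G₂ total⇒embedding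
      ... | σ , iso , σ≗f = σ , iso , λ i →
        ≡.subst (λ j → ¬ (x i j ≈ 0#)) (≡.sym (σ≗f i)) (proj₂ (support i))

    -- When `w` is non-zero, no row is zero, so the support contains an isomorphism `σ`. The row
    -- constraint leaves nothing off `σ`, and the one remaining entry of each row must be the row
    -- sum `w`.
    constantRowSum⇒multiple : ∀ {w} → (∀ i → w ≈ sum (x i)) → Isomorphic G₁ G₂ →
      Σ[ σ ∈ Permutation′ n ] IsIsomorphism G₁ G₂ σ ×
        (∀ i j → x i j ≈ w * permutationMatrix σ i j)
    constantRowSum⇒multiple {w} w≈rowSum (σ₀ , iso₀) with w ≟ 0#
    -- The block is zero and selects no permutation, so the given isomorphism serves as the default.
    ... | yes w≈0 = σ₀ , iso₀ , λ i j → trans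
      (sum≈0⇒f[i]≈0 (nonNegative i) (trans (sym (w≈rowSum i)) w≈0) j)
      (sym (trans (*-congʳ w≈0) (zeroˡ _)))
    ... | no w≉0 with total⇒isomorphism (λ i rowSum≈0 → w≉0 (trans (w≈rowSum i) rowSum≈0))
    ...   | σ , iso , xσ≉0 = σ , iso , x≈wP
      where
      off : ∀ i j → j ≢ σ ⟨$⟩ʳ i → x i j ≈ 0#
      off i j j≢σi with xy≈0⇒x≈0∨y≈0 (row i j (σ ⟨$⟩ʳ i) j≢σi)
      ... | inj₁ x≈0  = x≈0
      ... | inj₂ xσ≈0 = contradiction xσ≈0 (xσ≉0 i)

      x≈wP : ∀ i j → x i j ≈ w * permutationMatrix σ i j
      x≈wP i j with permutationMatrix-cases σ i j
      ... | inj₂ (j≢σi , p≈0) = trans (off i j j≢σi) (sym (trans (*-congˡ p≈0) (zeroʳ w)))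
      ... | inj₁ (≡.refl , p≈1) = begin-equality
        x i j                            ≈⟨ sum-single (x i) j (off i) ⟨
        sum (x i)                        ≈⟨ w≈rowSum i ⟨
        w                                ≈⟨ *-identityʳ w ⟨
        w * 1#                           ≈⟨ *-congˡ p≈1 ⟨
        w * permutationMatrix σ i j      ∎

  -- Columns of a factorisation of a feasible matrix.

  module Feasible {Y : Matrix Index} (feasible : IsFeasible Y) where
    open IsFeasible feasible

    factor = proj₂ (proj₂ completelyPositive)
    Q = proj₁ factor
    Q-nonNegative = proj₁ (proj₂ factor)
    Y≈QQᵀ = proj₂ (proj₂ factor)

    w = Q ω
    x = λ t i j → Q (i ,, j) t

    -- Here complete positivity enters: a vanishing sum of non-negative products vanishes term by
    -- term, which carries each zero of `Y` to every column of `Q`.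
    Y≈0⇒QQ≈0 : ∀ {p q} → Y p q ≈ 0# → ∀ t → Q p t * Q q t ≈ 0#
    Y≈0⇒QQ≈0 {p} {q} Y≈0 = sum≈0⇒f[i]≈0
      (λ t → *-nonNegative _ _ (Q-nonNegative p t) (Q-nonNegative q t))
      (trans (sym (Y≈QQᵀ p q)) Y≈0)

    x-partial : ∀ t → IsPartialIsomorphism (x t)
    x-partial t = record
      { nonNegative = λ i j → Q-nonNegative (i ,, j) t
      ; row         = λ i j k j≢k → Y≈0⇒QQ≈0 (row i j k j≢k) t
      ; column      = λ i j k j≢k → Y≈0⇒QQ≈0 (column i j k j≢k) t
      ; edge₁       = λ i j k l e₁ ¬e₂ → Y≈0⇒QQ≈0 (edge₁ i j k l e₁ ¬e₂) t
      ; edge₂       = λ i j k l ¬e₁ e₂ → Y≈0⇒QQ≈0 (edge₂ i j k l ¬e₁ e₂) t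
      }

    T : Carrier
    T = trace (drop-ω Y)

    r = λ t i → sum (x t i)

    defect = λ t i → (w t - r t i) * (w t - r t i)

    ∑w²≈1 : sum (λ t → w t * w t) ≈ 1#
    ∑w²≈1 = trans (sym (Y≈QQᵀ ω ω)) corner

    ∑∑w²≈n : sum (λ t → sum {n} λ i → w t * w t) ≈ fromℕ n
    ∑∑w²≈n = ∑c≈1⇒∑∑c≈n n (λ t → w t * w t) ∑w²≈1

    -- The trace read off the diagonal, each squared row sum being the sum of the squared entries.
    ∑∑r²≈T : sum (λ t → sum λ i → r t i * r t i) ≈ T
    ∑∑r²≈T = begin-equality
      (sum λ t → sum λ i → r t i * r t i)
        ≈⟨ ∑∑-cong (λ t i → sum-sq (x t i) (IsPartialIsomorphism.row (x-partial t) i)) ⟩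
      (sum λ t → sum λ i → sum λ j → x t i j * x t i j)
        ≈⟨ ∑∑∑-rotate (λ t i j → x t i j * x t i j) ⟩
      (sum λ i → sum λ j → sum λ t → x t i j * x t i j)
        ≈⟨ ∑∑-cong (λ i j → Y≈QQᵀ (i ,, j) (i ,, j)) ⟨
      T ∎

    -- The same trace read off the `ω` column, through the border constraint.
    ∑∑rw≈T : sum (λ t → sum λ i → r t i * w t) ≈ T
    ∑∑rw≈T = begin-equality
      (sum λ t → sum λ i → r t i * w t)
        ≈⟨ ∑∑-cong (λ t i → *-distribʳ-sum (w t) (x t i)) ⟩
      (sum λ t → sum λ i → sum λ j → x t i j * w t)
        ≈⟨ ∑∑∑-rotate (λ t i j → x t i j * w t) ⟩
      (sum λ i → sum λ j → sum λ t → x t i j * w t)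
        ≈⟨ ∑∑-cong (λ i j → trans (sym (border i j)) (Y≈QQᵀ (i ,, j) ω)) ⟨
      T ∎

    -- Summing `w² + r² = 2rw + (w - r)²` gives `n + T = 2T + D`, and one `T` cancels.
    T+defect≈n : T + sum (λ t → sum (defect t)) ≈ fromℕ n
    T+defect≈n = ∙-cancelˡ T _ _ (begin-equality
      T + (T + D)
        ≈⟨ +-assoc T T D ⟨
      (T + T) + D
        ≈⟨ +-congʳ (+-cong ∑∑rw≈T ∑∑rw≈T) ⟨
      (∑∑rw + ∑∑rw) + D
        ≈⟨ +-congʳ (∑∑-distrib-+ rw rw) ⟨
      (sum λ t → sum λ i → rw t i + rw t i) + D
        ≈⟨ ∑∑-distrib-+ (λ t i → rw t i + rw t i) defect ⟨
      (sum λ t → sum λ i → (rw t i + rw t i) + defect t i)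
        ≈⟨ ∑∑-cong (λ t i → x²+y²≈2xy+[x-y]² (w t) (r t i)) ⟨
      (sum λ t → sum λ i → w t * w t + r t i * r t i)
        ≈⟨ ∑∑-distrib-+ (λ t i → w t * w t) (λ t i → r t i * r t i) ⟩
      (sum λ t → sum {n} λ i → w t * w t) + (sum λ t → sum λ i → r t i * r t i)
        ≈⟨ +-cong ∑∑w²≈n ∑∑r²≈T ⟩
      fromℕ n + T
        ≈⟨ +-comm (fromℕ n) T ⟩
      T + fromℕ n ∎)
      where
      D = sum λ t → sum (defect t)
      rw = λ t i → r t i * w t
      ∑∑rw = sum λ t → sum (rw t)

    defect-nonNegative : ∀ t i → 0# ≤ defect t i
    defect-nonNegative t i = x²-nonNegative (w t - r t i)

    trace≤n : T ≤ fromℕ n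
    trace≤n = begin
      T                                ≤⟨ x≤x+y T (sum-nonNegative λ t → sum-nonNegative (defect-nonNegative t)) ⟩
      T + (sum λ t → sum (defect t))   ≈⟨ T+defect≈n ⟩
      fromℕ n                          ∎

    -- A zero row in column `t` alone costs a defect of `w t * w t`, and these costs add up to one
    -- over all columns.
    ¬isomorphic⇒trace+1≤n : ¬ Isomorphic G₁ G₂ → T + 1# ≤ fromℕ n
    ¬isomorphic⇒trace+1≤n ≇ = begin
      T + 1#                           ≈⟨ +-congˡ ∑w²≈1 ⟨
      T + sum (λ t → w t * w t)        ≤⟨ +-monoʳ-≤ T (sum-mono-≤ w²≤defect) ⟩
      T + (sum λ t → sum (defect t))   ≈⟨ T+defect≈n ⟩
      fromℕ n                          ∎
      where
      emptyRow⇒w²≤defect : ∀ t i → r t i ≈ 0# → w t * w t ≤ sum (defect t)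
      emptyRow⇒w²≤defect t i r≈0 = begin
        w t * w t      ≈⟨ *-cong w-r≈w w-r≈w ⟨
        defect t i     ≤⟨ f[i]≤sum (defect-nonNegative t) i ⟩
        sum (defect t) ∎
        where
        w-r≈w : w t - r t i ≈ w t
        w-r≈w = trans (+-congˡ (trans (-‿cong r≈0) ε⁻¹≈ε)) (+-identityʳ (w t))

      emptyRow : ∀ t → ∃[ i ] r t i ≈ 0#
      -- A block with no zero row would supply an isomorphism.
      emptyRow t = decidable-stable (any? λ i → r t i ≟ 0#) λ ∄i →
        ≇ (map₂ proj₁ (total⇒isomorphism (x-partial t) λ i r≈0 → ∄i (i , r≈0)))

      w²≤defect : ∀ t → w t * w t ≤ sum (defect t)
      w²≤defect t = uncurry (emptyRow⇒w²≤defect t) (emptyRow t)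

    -- Every defect vanishes, so each column contributes `P[2] (σ t)` scaled by `w t * w t`. These
    -- squares are the convex coefficients, and their sum is the corner entry of `Y`.
    trace≈n⇒hull : T ≈ fromℕ n → Isomorphic G₁ G₂ → 𝒫 (drop-ω Y)
    trace≈n⇒hull T≈n iso =
      _ , (λ t → w t * w t) , (λ t → P[2] (σ t)) ,
      (λ t → x²-nonNegative (w t)) , ∑w²≈1 ,
      (λ t → σ t , proj₁ (proj₂ (multiple t)) , λ _ _ → refl) ,
      λ { (i , j) (k , l) → trans (Y≈QQᵀ (i ,, j) (k ,, l)) (sum-cong-≋ λ t → begin-equality
        x t i j * x t k l ≈⟨ *-cong (x≈wP t i j) (x≈wP t k l) ⟩
        (w t * P t i j) * (w t * P t k l)
          ≈⟨ solve 3 (λ w p q → (w :* p) :* (w :* q) := (w :* w) :* (p :* q)) refl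
               (w t) (P t i j) (P t k l) ⟩
        (w t * w t) * (P t i j * P t k l) ∎) }
      where
      defect≈0 : ∀ t i → defect t i ≈ 0#
      defect≈0 t = sum≈0⇒f[i]≈0 (defect-nonNegative t)
        (sum≈0⇒f[i]≈0 (λ t → sum-nonNegative (defect-nonNegative t))
          (∙-cancelˡ T _ _ (trans T+defect≈n (trans (sym T≈n) (sym (+-identityʳ T))))) t)

      multiple = λ t → constantRowSum⇒multiple (x-partial t)
        (λ i → x∙y⁻¹≈ε⇒x≈y _ _ (x²≈0⇒x≈0 (defect≈0 t i))) iso
      σ = λ t → proj₁ (multiple t)
      x≈wP = λ t → proj₂ (proj₂ (multiple t))
      P = λ t → permutationMatrix (σ t)

  -- From convex combinations to feasible matrices.

  hull⇒trace≈n : ∀ {M} → 𝒫 M → trace M ≈ fromℕ n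
  hull⇒trace≈n {M} (m , c , A , _ , ∑c≈1 , A-iso , M≈∑cA) = begin-equality
    trace M
      ≈⟨ ∑∑-cong (λ i j → M≈∑cA (i , j) (i , j)) ⟩
    (sum λ i → sum λ j → sum λ t → c t * A t (i , j) (i , j))
      ≈⟨ ∑∑∑-rotate (λ t i j → c t * A t (i , j) (i , j)) ⟨
    (sum λ t → sum λ i → sum λ j → c t * A t (i , j) (i , j))
      ≈⟨ ∑∑-cong rowSum ⟩
    (sum λ t → sum {n} λ i → c t)
      ≈⟨ ∑c≈1⇒∑∑c≈n n c ∑c≈1 ⟩
    fromℕ n ∎
    where
    rowSum : ∀ t i → sum (λ j → c t * A t (i , j) (i , j)) ≈ c t
    rowSum t i with A-iso t
    ... | σ , _ , A≋P = begin-equality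
      sum (λ j → c t * A t (i , j) (i , j))
        ≈⟨ *-distribˡ-sum (c t) (λ j → A t (i , j) (i , j)) ⟨
      c t * sum (λ j → A t (i , j) (i , j))
        -- The diagonal of `P[2] σ` reproduces the permutation matrix, since its entries are
        -- idempotent.
        ≈⟨ *-congˡ (sum-cong-≋ λ j → trans (A≋P (i , j) (i , j)) (permutationMatrix-idem σ i j)) ⟩
      c t * sum (permutationMatrix σ i)
        ≈⟨ *-congˡ (permutationMatrix-rowSum σ i) ⟩
      c t * 1#
        ≈⟨ *-identityʳ (c t) ⟩
      c t ∎

  -- A coefficient occurs once in `M` but is shared by two factors of `Q`, hence `sqrt`. The zero
  -- constraints hold in each summand separately, because every `σ t` is a bijective function and an
  -- isomorphism.
  hull⇒feasible : ∀ {M} → 𝒫 M → FeasibleRegion M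
  hull⇒feasible {M} (m , c , A , 0≤c , ∑c≈1 , A-iso , M≈∑cA) = Y , Y-feasible , M≋Y
    where
    s = λ t → proj₁ (sqrt (0≤c t))
    0≤s = λ t → proj₁ (proj₂ (sqrt (0≤c t)))
    s²≈c = λ t → proj₂ (proj₂ (sqrt (0≤c t)))
    σ = λ t → proj₁ (A-iso t)
    σ-iso = λ t → proj₁ (proj₂ (A-iso t))
    P = λ t → permutationMatrix (σ t)

    Q : Index → Fin m → Carrier
    Q ω        t = s t
    Q (i ,, j) t = s t * P t i j

    Y : Matrix Index
    Y p q = sum λ t → Q p t * Q q t

    Q-nonNegative : ∀ p t → 0# ≤ Q p t
    Q-nonNegative ω        t = 0≤s t
    Q-nonNegative (i ,, j) t = *-nonNegative _ _ (0≤s t) (permutationMatrix-nonNegative (σ t) i j)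

    QQ≈cP[2] : ∀ t i j k l → Q (i ,, j) t * Q (k ,, l) t ≈ c t * P[2] (σ t) (i , j) (k , l)
    QQ≈cP[2] t i j k l = begin-equality
      (s t * P t i j) * (s t * P t k l)
        ≈⟨ solve 3 (λ s p q → (s :* p) :* (s :* q) := (s :* s) :* (p :* q)) refl
             (s t) (P t i j) (P t k l) ⟩
      (s t * s t) * (P t i j * P t k l)
        ≈⟨ *-congʳ (s²≈c t) ⟩
      c t * (P t i j * P t k l) ∎

    M≋Y : M ≋ drop-ω Y
    M≋Y (i , j) (k , l) = trans (M≈∑cA (i , j) (k , l)) (sum-cong-≋ λ t →
      trans (*-congˡ (proj₂ (proj₂ (A-iso t)) (i , j) (k , l))) (sym (QQ≈cP[2] t i j k l)))

    Y≈0 : ∀ i j k l → (∀ t → ¬ (j ≡ σ t ⟨$⟩ʳ i × l ≡ σ t ⟨$⟩ʳ k)) → Y (i ,, j) (k ,, l) ≈ 0#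
    Y≈0 i j k l ≢ = sum-≈0 λ t →
      trans (QQ≈cP[2] t i j k l) (trans (*-congˡ (P[2]≈0 (σ t) i j k l (≢ t))) (zeroʳ (c t)))

    Y-feasible : IsFeasible Y
    Y-feasible = record
      { completelyPositive =
          (λ p q → sum-cong-≋ λ t → *-comm (Q p t) (Q q t)) , m , Q , Q-nonNegative , λ _ _ → refl
      ; corner = trans (sum-cong-≋ s²≈c) ∑c≈1
      -- The `ω` column carries the permutation entry once and the diagonal carries it twice;
      -- idempotence reconciles them.
      ; border = λ i j → sum-cong-≋ λ t → begin-equality
          (s t * P t i j) * s t             ≈⟨ *-congʳ (*-congˡ (permutationMatrix-idem (σ t) i j)) ⟨
          (s t * (P t i j * P t i j)) * s t ≈⟨ solve 2 (λ s p →
            (s :* (p :* p)) :* s := (s :* p) :* (s :* p)) refl (s t) (P t i j) ⟩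
          (s t * P t i j) * (s t * P t i j) ∎
      ; row    = λ i j k j≢k → Y≈0 i j i k λ { t (j≡ , k≡) → j≢k (≡.trans j≡ (≡.sym k≡)) }
      ; column = λ i j k j≢k → Y≈0 j i k i λ { t (i≡ , i≡′) →
          j≢k (Injection.injective (↔⇒↣ (σ t)) (≡.trans (≡.sym i≡) i≡′)) }
      ; edge₁  = λ i j k l e₁ ¬e₂ → Y≈0 i j k l λ { t (≡.refl , ≡.refl) →
          ¬e₂ (Equivalence.from (σ-iso t i k) e₁) }
      ; edge₂  = λ i j k l ¬e₁ e₂ → Y≈0 i j k l λ { t (≡.refl , ≡.refl) →
          ¬e₁ (Equivalence.to (σ-iso t i k) e₂) }
      }

  isomorphism⇒hull : ∀ σ → IsIsomorphism G₁ G₂ σ → 𝒫 (P[2] σ)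
  isomorphism⇒hull σ iso =
    1 , (λ _ → 1#) , (λ _ → P[2] σ) , (λ _ → 0≤1) , +-identityʳ 1# ,
    (λ _ → σ , iso , λ _ _ → refl) ,
    λ p q → sym (trans (+-identityʳ _) (*-identityˡ _))

  -- The optimal value and the matrices that attain it.

  trace-cong : ∀ {M N : Matrix Pair} → M ≋ N → trace M ≈ trace N
  trace-cong M≋N = ∑∑-cong λ i j → M≋N (i , j) (i , j)

  𝒫-resp-≋ : ∀ {M N} → M ≋ N → 𝒫 N → 𝒫 M
  𝒫-resp-≋ M≋N (m , c , A , 0≤c , ∑c≈1 , A-iso , N≈∑cA) =
    m , c , A , 0≤c , ∑c≈1 , A-iso , λ p q → trans (M≋N p q) (N≈∑cA p q)

  -- Without an isomorphism `fromℕ n - 1#` bounds all objective values, contradicting that `fromℕ n`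
  -- is their least upper bound.
  optimal⇒isomorphic : IsOptimalValue (fromℕ n) → Isomorphic G₁ G₂
  optimal⇒isomorphic (_ , n-least) = decidable-stable (isomorphic? G₁ G₂) λ ≇ →
    let n-1-upper : IsUpperBound _≤_ _ (fromℕ n - 1#)
        n-1-upper = λ { v (Y , feasible , v≈T) → +-cancelʳ-≤ 1# (begin
          v + 1#                 ≈⟨ +-congʳ v≈T ⟩
          trace (drop-ω Y) + 1#  ≤⟨ Feasible.¬isomorphic⇒trace+1≤n feasible ≇ ⟩
          fromℕ n                ≈⟨ x+[y-x]≈y 1# (fromℕ n) ⟨
          1# + (fromℕ n - 1#)    ≈⟨ +-comm 1# _ ⟩
          (fromℕ n - 1#) + 1#    ∎) }
        1≤0 : 1# ≤ 0#
        1≤0 = +-cancelʳ-≤ (fromℕ n - 1#) (begin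
          1# + (fromℕ n - 1#)    ≈⟨ x+[y-x]≈y 1# (fromℕ n) ⟩
          fromℕ n                ≤⟨ n-least (fromℕ n - 1#) n-1-upper ⟩
          fromℕ n - 1#           ≈⟨ +-identityˡ _ ⟨
          0# + (fromℕ n - 1#)    ∎)
    in 0≉1 (antisym 0≤1 1≤0)

  -- The upper bound `trace≤n` is attained by `P[2] σ`, so every other upper bound lies above it.
  isomorphic⇒optimal : Isomorphic G₁ G₂ → IsOptimalValue (fromℕ n)
  isomorphic⇒optimal (σ , iso) with hull⇒feasible (isomorphism⇒hull σ iso)
  ... | Y , feasible , P≋Y =
    (λ { v (_ , feasible′ , v≈T) → ≤-trans (≤-reflexive v≈T) (Feasible.trace≤n feasible′) }) ,
    λ u u-upper → u-upper (fromℕ n)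
      (Y , feasible , trans (sym (hull⇒trace≈n (isomorphism⇒hull σ iso))) (trace-cong P≋Y))

  value-n⇔hull : Isomorphic G₁ G₂ → ∀ M → FeasibleRegionOfValue-n M ⇔ 𝒫 M
  value-n⇔hull iso M = mk⇔
    (λ { ((Y , feasible , M≋Y) , traceM≈n) → 𝒫-resp-≋ M≋Y
      (Feasible.trace≈n⇒hull feasible (trans (sym (trace-cong M≋Y)) traceM≈n) iso) })
    (λ M∈𝒫 → hull⇒feasible M∈𝒫 , hull⇒trace≈n M∈𝒫)

lemma5 : (ℝ : RealNumbers) (n : ℕ) (G₁ G₂ : SimpleGraph n) →
    let open CP-LT ℝ G₁ G₂ in
    (IsOptimalValue (fromℕ n) ⇔ Isomorphic G₁ G₂) ×
    (Isomorphic G₁ G₂ → ∀ M → FeasibleRegionOfValue-n M ⇔ 𝒫 M)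
lemma5 ℝ n G₁ G₂ = mk⇔ optimal⇒isomorphic isomorphic⇒optimal , value-n⇔hull
  where open CP-LTProperties ℝ G₁ G₂
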